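{- Let $m \geq 2$ and put $n = 2m-1$. For every prime power $q$ there exists a $(4,2)$-set $X_q$ in $\mathrm{PG}(n,q)$ with $|X_q| = (1+o(1))\, q^{\frac{n-1}{2}}$ as $q \to \infty$.
   Context: $\mathrm{PG}(n,q)$ is the projective space whose points are the $1$-dimensional subspaces of $\mathbb{F}_q^{n+1}$; a plane is a $3$-dimensional vector subspace. A $(4,2)$-set is a set of points such that every plane contains at most $4$ of its points. -}

module Defs where

open import Level using (0ℓ)
open import Data.Nat using (ℕ; suc; _≤_)
open import Data.Product using (Σ; ∃; _×_; _,_)
open import Data.List using (List; length)
open import Data.List.Relation.Unary.All using (All)
open import Data.List.Relation.Unary.AllPairs using (AllPairs)
open import Data.List.Relation.Unary.Unique.Propositional using (Unique)
open import Data.List.Membership.Propositional using (_∈_)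
open import Data.List.Relation.Binary.Sublist.Propositional using (_⊆_)
open import Data.Vec using (Vec; replicate; map; zipWith)
open import Algebra.Structures using (IsCommutativeRing)
open import Relation.Binary.PropositionalEquality using (_≡_)
open import Relation.Binary.Definitions using (DecidableEquality)
open import Relation.Nullary using (¬_)

record FiniteField : Set₁ where
  infixl 6 _+_
  infixl 7 _*_
  field
    Carrier   : Set
    _+_ _*_   : Carrier → Carrier → Carrier
    -_        : Carrier → Carrier
    0# 1#     : Carrier
    isCommutativeRing : IsCommutativeRing _≡_ _+_ _*_ -_ 0# 1#
    0≢1       : ¬ (0# ≡ 1#)
    inverse   : ∀ x → ¬ (x ≡ 0#) → ∃ λ y → x * y ≡ 1#
    _≟_       : DecidableEquality Carrier
    elements  : List Carrier
    elements-unique   : Unique elements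
    elements-complete : ∀ x → x ∈ elements

  order : ℕ
  order = length elements

module Geometry (𝔽 : FiniteField) (n : ℕ) where
  open FiniteField 𝔽

  V : Set
  V = Vec Carrier (suc n)

  𝟎 : V
  𝟎 = replicate (suc n) 0#

  _·_ : Carrier → V → V
  λ′ · v = map (λ′ *_) v

  _⊕_ : V → V → V
  _⊕_ = zipWith _+_

  -- u and v span the same 1-dimensional subspace (for nonzero u, v)
  SamePoint : V → V → Set
  SamePoint u v = ∃ λ λ′ → u ≡ λ′ · v

  -- a set of points of PG(n,q), given by a list of nonzero representative vectors,
  -- no two representing the same point
  IsPointSet : List V → Set
  IsPointSet X = All (λ v → ¬ (v ≡ 𝟎)) X × AllPairs (λ u v → ¬ SamePoint u v) X

  LinIndep3 : V → V → V → Set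
  LinIndep3 a b c = ∀ α β γ → ((α · a) ⊕ (β · b)) ⊕ (γ · c) ≡ 𝟎 →
                    (α ≡ 0#) × (β ≡ 0#) × (γ ≡ 0#)

  InSpan : V → V → V → V → Set
  InSpan a b c v = ∃ λ α → ∃ λ β → ∃ λ γ → v ≡ ((α · a) ⊕ (β · b)) ⊕ (γ · c)

  -- (4,2)-set: every plane (3-dim subspace = span of three independent vectors)
  -- contains at most 4 points of X
  Is42Set : List V → Set
  Is42Set X = IsPointSet X ×
    (∀ a b c → LinIndep3 a b c →
      ∀ (Y : List V) → Y ⊆ X → All (InSpan a b c) Y → length Y ≤ 4)

{-# OPTIONS --safe #-}
module Submission where

-- Write m = r + 1 and let X consist of the (q − 1)ʳ points with coordinates x₀, …, xᵣ and
-- x₁²/x₀, x₂²/x₁, …, xᵣ₊₁²/xᵣ, where x₀ = xᵣ₊₁ = 1 and all xᵢ are nonzero. Suppose five of them lie in a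
-- plane; any four coordinate functions are then linearly dependent on the five points. Take the first
-- coordinate v = xᵢ₊₁ that is not constant on them, so that 1, v and v² are (multiples of) coordinates.
--  * If v takes at least three values, every coordinate is a quadratic polynomial in v, so v is injective
--    on the five points. If xⱼ = ρv, then writing xⱼ₊₁ = A(v) and xⱼ₊₁²/xⱼ = B(v) gives A² = ρvB at
--    five points, hence as polynomials of degree ≤ 4, which forces xⱼ₊₁ = A(v) = bv. So every later
--    coordinate xⱼ is a multiple of v, contradicting xᵣ₊₁ = 1.
--  * If v takes two values, three of the points lie on a line, and the same reasoning one dimension
--    lower makes the first nonconstant z = xⱼ₊₁ injective on them while z² is affine in z: impossible.

open import Defs
open import Level using (0ℓ)
open import Algebra.Bundles using (CommutativeRing)
open import Data.Empty using (⊥; ⊥-elim)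
open import Data.Fin using (Fin; zero; suc; punchIn; toℕ; fromℕ<; inject≤; _↑ˡ_; _↑ʳ_)
open import Data.Fin.Patterns
open import Data.Fin.Properties using (all?; any?; ¬∀⟶∃¬; suc-injective; toℕ-fromℕ<; inject≤-injective)
open import Data.List as List using (List; []; _∷_; length; filter; cartesianProductWith)
open import Data.List.Membership.Propositional using (_∈_)
open import Data.List.Membership.Propositional.Properties using (∈-lookup)
open import Data.List.Properties using (length-map; length-++; filter-all; filter-accept; filter-reject)
open import Data.List.Relation.Binary.Sublist.Propositional using (_⊆_; []; _∷ʳ_; _∷_)
open import Data.List.Relation.Binary.Sublist.Propositional.Properties using (All-resp-⊆)
open import Data.List.Relation.Unary.All as ListAll using ([]; _∷_)
import Data.List.Relation.Unary.All.Properties as ListAll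
open import Data.List.Relation.Unary.AllPairs as AllPairs using (AllPairs; []; _∷_)
import Data.List.Relation.Unary.AllPairs.Properties as AllPairs
open import Data.List.Relation.Unary.Any using (here; there)
open import Data.List.Relation.Unary.Unique.Propositional using (Unique)
import Data.List.Relation.Unary.Unique.Propositional.Properties as Unique
open import Data.Nat as ℕ using (ℕ; zero; suc; _∸_; s≤s)
open import Data.Nat.Properties using (m≤m+n; m≤n⇒m≤1+n; ≰⇒>)
open import Data.Product using (Σ; ∃; _×_; _,_; proj₁; proj₂)
open import Data.Sum using (_⊎_; inj₁; inj₂; swap)
open import Data.Vec using (Vec; []; _∷_; replicate; lookup; map; tabulate; _++_)
open import Data.Vec.Functional using (insertAt)
open import Data.Vec.Functional.Properties using (insertAt-lookup; insertAt-punchIn)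
open import Data.Vec.Properties using (∷-injective; lookup-replicate; lookup-map; lookup-zipWith; lookup-++ˡ; lookup-++ʳ; lookup∘tabulate)
open import Data.Vec.Relation.Unary.All using (All; []; _∷_)
open import Function using (_∘_; const; id)
open import Function.Definitions using (Injective)
open import Relation.Binary.Definitions using (DecidableEquality)
open import Relation.Binary.PropositionalEquality
open import Relation.Nullary using (¬_; Dec; yes; no; contradiction; ¬?)
open import Relation.Nullary.Decidable using (_×-dec_; decidable-stable)

-- Lists without repetition, and a pigeonhole principle for five points.

AllPairs-resp-⊆ : ∀ {A : Set} {R : A → A → Set} {xs ys} → xs ⊆ ys → AllPairs R ys → AllPairs R xs
AllPairs-resp-⊆ []         []         = []
AllPairs-resp-⊆ (_ ∷ʳ τ)   (_ ∷ Rys)  = AllPairs-resp-⊆ τ Rys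
AllPairs-resp-⊆ (refl ∷ τ) (Ry ∷ Rys) = All-resp-⊆ τ Ry ∷ AllPairs-resp-⊆ τ Rys

lookup-injective : ∀ {A : Set} {xs : List A} → Unique xs → Injective _≡_ _≡_ (List.lookup xs)
lookup-injective (_ ∷ _)    {zero}  {zero}  _  = refl
lookup-injective (x∉ ∷ _)   {zero}  {suc j} eq = contradiction eq (ListAll.lookup x∉ (∈-lookup j))
lookup-injective (x∉ ∷ _)   {suc i} {zero}  eq = contradiction (sym eq) (ListAll.lookup x∉ (∈-lookup i))
lookup-injective (_ ∷ xs!)  {suc i} {suc j} eq = cong suc (lookup-injective xs! eq)

⊆-map⁻ : ∀ {A B : Set} (f : A → B) xs {ys} → ys ⊆ List.map f xs → ∃ λ zs → zs ⊆ xs × ys ≡ List.map f zs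
⊆-map⁻ f []       []         = [] , [] , refl
⊆-map⁻ f (x ∷ xs) (_ ∷ʳ τ)   = let zs , zs⊆xs , eq = ⊆-map⁻ f xs τ in zs , x ∷ʳ zs⊆xs , eq
⊆-map⁻ f (x ∷ xs) (refl ∷ τ) = let zs , zs⊆xs , eq = ⊆-map⁻ f xs τ in x ∷ zs , refl ∷ zs⊆xs , cong (f x ∷_) eq

length-filter-≢ : ∀ {A : Set} (_≟_ : DecidableEquality A) {x xs} → Unique xs → x ∈ xs →
  length xs ≡ suc (length (filter (λ y → ¬? (y ≟ x)) xs))
length-filter-≢ _≟_ {x} {x ∷ xs} (x∉ ∷ _) (here refl) = cong suc (sym (cong length
  (trans (filter-reject (λ y → ¬? (y ≟ x)) (λ x≢x → x≢x refl)) (filter-all (λ y → ¬? (y ≟ x)) (ListAll.map (_∘ sym) x∉)))))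
length-filter-≢ _≟_ {x} {y ∷ xs} (y∉ ∷ xs!) (there x∈) = trans (cong suc (length-filter-≢ _≟_ xs! x∈))
  (cong (suc ∘ length) (sym (filter-accept (λ z → ¬? (z ≟ x)) (ListAll.lookup y∉ x∈))))

length-cartesianProductWith : ∀ {A B C : Set} (f : A → B → C) xs ys →
  length (cartesianProductWith f xs ys) ≡ length xs ℕ.* length ys
length-cartesianProductWith f []       ys = refl
length-cartesianProductWith f (x ∷ xs) ys = trans (length-++ (List.map (f x) ys))
  (cong₂ ℕ._+_ (length-map (f x) ys) (length-cartesianProductWith f xs ys))

triple-injective : ∀ {A B : Set} (f : A → B) {a b c} → f a ≢ f b → f a ≢ f c → f b ≢ f c →
  Injective _≡_ _≡_ (f ∘ lookup (a ∷ b ∷ c ∷ []))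
triple-injective f ab ac bc {0F} {0F} _  = refl
triple-injective f ab ac bc {0F} {1F} eq = contradiction eq ab
triple-injective f ab ac bc {0F} {2F} eq = contradiction eq ac
triple-injective f ab ac bc {1F} {0F} eq = contradiction (sym eq) ab
triple-injective f ab ac bc {1F} {1F} _  = refl
triple-injective f ab ac bc {1F} {2F} eq = contradiction eq bc
triple-injective f ab ac bc {2F} {0F} eq = contradiction (sym eq) ac
triple-injective f ab ac bc {2F} {1F} eq = contradiction (sym eq) bc
triple-injective f ab ac bc {2F} {2F} _  = refl

∀-triple : ∀ {A : Set} (P : A → Set) {a b c} → P a → P b → P c → ∀ j → P (lookup (a ∷ b ∷ c ∷ []) j)
∀-triple P a b c 0F = a
∀-triple P a b c 1F = b
∀-triple P a b c 2F = c

ThreeAlike : (P Q : Fin 5 → Set) → Set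
ThreeAlike P Q = ∃ λ (t : Fin 3 → Fin 5) → Injective _≡_ _≡_ t × ((∀ j → P (t j)) ⊎ (∀ j → Q (t j)))

-- Point `0F` already has the first colour. Either two of the other four share it (six clauses), or
-- at least three of them have the second colour (four clauses).
three-alike₀ : ∀ {P Q : Fin 5 → Set} → P 0F → (∀ k → P k ⊎ Q k) → ThreeAlike P Q
three-alike₀ {P} {Q} p₀ colour with colour 1F | colour 2F | colour 3F | colour 4F
... | inj₁ a | inj₁ b | _      | _      = _ , triple-injective id (λ ()) (λ ()) (λ ()) , inj₁ (∀-triple P p₀ a b)
... | inj₁ a | _      | inj₁ b | _      = _ , triple-injective id (λ ()) (λ ()) (λ ()) , inj₁ (∀-triple P p₀ a b)
... | inj₁ a | _      | _      | inj₁ b = _ , triple-injective id (λ ()) (λ ()) (λ ()) , inj₁ (∀-triple P p₀ a b)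
... | _      | inj₁ a | inj₁ b | _      = _ , triple-injective id (λ ()) (λ ()) (λ ()) , inj₁ (∀-triple P p₀ a b)
... | _      | inj₁ a | _      | inj₁ b = _ , triple-injective id (λ ()) (λ ()) (λ ()) , inj₁ (∀-triple P p₀ a b)
... | _      | _      | inj₁ a | inj₁ b = _ , triple-injective id (λ ()) (λ ()) (λ ()) , inj₁ (∀-triple P p₀ a b)
... | inj₂ a | inj₂ b | inj₂ c | _      = _ , triple-injective id (λ ()) (λ ()) (λ ()) , inj₂ (∀-triple Q a b c)
... | inj₂ a | inj₂ b | _      | inj₂ c = _ , triple-injective id (λ ()) (λ ()) (λ ()) , inj₂ (∀-triple Q a b c)
... | inj₂ a | _      | inj₂ b | inj₂ c = _ , triple-injective id (λ ()) (λ ()) (λ ()) , inj₂ (∀-triple Q a b c)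
... | _      | inj₂ a | inj₂ b | inj₂ c = _ , triple-injective id (λ ()) (λ ()) (λ ()) , inj₂ (∀-triple Q a b c)

three-alike : ∀ {P Q : Fin 5 → Set} → (∀ k → P k ⊎ Q k) → ThreeAlike P Q
three-alike colour with colour 0F
... | inj₁ p₀ = three-alike₀ p₀ colour
... | inj₂ q₀ = let t , t-inj , alike = three-alike₀ q₀ (swap ∘ colour) in t , t-inj , swap alike

module Field (𝔽 : FiniteField) where
  open ≡-Reasoning
  open FiniteField 𝔽 public

  -- Field arithmetic: inverses and cancellation.

  ring : CommutativeRing 0ℓ 0ℓ
  ring = record { isCommutativeRing = isCommutativeRing }

  open CommutativeRing ring public
    using (+-identityˡ; +-identityʳ; -‿inverseˡ; -‿inverseʳ; *-comm; *-assoc; *-identityˡ;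
           *-identityʳ; zeroˡ; zeroʳ; distribʳ; semiring; commutativeSemiring)

  open import Algebra.Properties.Ring (CommutativeRing.ring ring) public
    using (-‿distribˡ-*; +-cancelˡ; +-cancelʳ)
  open import Algebra.Properties.Semiring.Sum semiring public
    using (sum; sum-cong-≗; sum-remove; sum-replicate-zero; ∑-distrib-+; ∑-comm; *-distribˡ-sum; *-distribʳ-sum)
  open import Algebra.Solver.Ring.NaturalCoefficients.Default commutativeSemiring public
    using (solve; _:+_; _:*_; _:=_; con)

  infix 8 _⁻¹
  _⁻¹ : Carrier → Carrier
  x ⁻¹ with x ≟ 0#
  -- An arbitrary value that makes inversion total; the inverse laws below assume `x ≢ 0#`.
  ... | yes _ = 0#
  ... | no x≢0 = proj₁ (inverse x x≢0)

  *-inverseʳ : ∀ {x} → x ≢ 0# → x * x ⁻¹ ≡ 1#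
  *-inverseʳ {x} x≢0 with x ≟ 0#
  ... | yes x≡0 = contradiction x≡0 x≢0
  ... | no x≢0′ = proj₂ (inverse x x≢0′)

  *-inverseˡ : ∀ {x} → x ≢ 0# → x ⁻¹ * x ≡ 1#
  *-inverseˡ x≢0 = trans (*-comm _ _) (*-inverseʳ x≢0)

  *-cancelˡ : ∀ {x y z} → x ≢ 0# → x * y ≡ x * z → y ≡ z
  *-cancelˡ {x} {y} {z} x≢0 xy≡xz = begin
    y              ≡⟨ expand y ⟩
    x ⁻¹ * (x * y) ≡⟨ cong (x ⁻¹ *_) xy≡xz ⟩
    x ⁻¹ * (x * z) ≡⟨ expand z ⟨
    z              ∎
    where
    expand : ∀ t → t ≡ x ⁻¹ * (x * t)
    expand t = begin
      t              ≡⟨ *-identityˡ t ⟨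
      1# * t         ≡⟨ cong (_* t) (*-inverseˡ x≢0) ⟨
      x ⁻¹ * x * t   ≡⟨ *-assoc _ _ _ ⟩
      x ⁻¹ * (x * t) ∎

  *-cancelʳ : ∀ {x y z} → x ≢ 0# → y * x ≡ z * x → y ≡ z
  *-cancelʳ x≢0 yx≡zx = *-cancelˡ x≢0 (trans (*-comm _ _) (trans yx≡zx (*-comm _ _)))

  *-nonzero : ∀ {x y} → x ≢ 0# → y ≢ 0# → x * y ≢ 0#
  *-nonzero {x} x≢0 y≢0 xy≡0 = y≢0 (*-cancelˡ x≢0 (trans xy≡0 (sym (zeroʳ x))))

  square-zero : ∀ {x} → x * x ≡ 0# → x ≡ 0#
  square-zero {x} xx≡0 = decidable-stable (x ≟ 0#) λ x≢0 → *-nonzero x≢0 x≢0 xx≡0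

  solve-linear : ∀ {d g s} → d ≢ 0# → d * g + s ≡ 0# → g ≡ - (d ⁻¹) * s
  solve-linear {d} {g} {s} d≢0 eq = +-cancelʳ (d ⁻¹ * s) _ _ (begin
    g + d ⁻¹ * s                ≡⟨ cong (_+ d ⁻¹ * s) (*-identityˡ g) ⟨
    1# * g + d ⁻¹ * s           ≡⟨ cong (λ e → e * g + d ⁻¹ * s) (*-inverseˡ d≢0) ⟨
    d ⁻¹ * d * g + d ⁻¹ * s     ≡⟨ solve 4 (λ e d g s → e :* d :* g :+ e :* s := e :* (d :* g :+ s)) refl (d ⁻¹) d g s ⟩
    d ⁻¹ * (d * g + s)          ≡⟨ cong (d ⁻¹ *_) eq ⟩
    d ⁻¹ * 0#                   ≡⟨ zeroʳ _ ⟩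
    0#                          ≡⟨ zeroˡ s ⟨
    0# * s                      ≡⟨ cong (_* s) (-‿inverseˡ (d ⁻¹)) ⟨
    (- (d ⁻¹) + d ⁻¹) * s       ≡⟨ distribʳ s _ _ ⟩
    - (d ⁻¹) * s + d ⁻¹ * s     ∎)

  -- Linear dependence.

  sum-zero : ∀ {n} {f : Fin n → Carrier} → (∀ j → f j ≡ 0#) → sum f ≡ 0#
  sum-zero {n} f≗0 = trans (sum-cong-≗ f≗0) (sum-replicate-zero n)

  -- Gaussian elimination, by induction on the number of coordinates. If the first coordinate
  -- vanishes on all vectors, it is dropped together with one vector; otherwise a pivot vector `w i`
  -- clears it from the others.
  linearly-dependent : ∀ k (w : Fin (suc k) → Fin k → Carrier) →
    ∃ λ (c : Fin (suc k) → Carrier) → (∃ λ j → c j ≢ 0#) × (∀ l → sum (λ j → c j * w j l) ≡ 0#)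
  linearly-dependent zero w = const 1# , (zero , 0≢1 ∘ sym) , λ ()
  linearly-dependent (suc k) w with all? (λ j → w j zero ≟ 0#)
  ... | yes column≡0 = c , (suc (proj₁ nz) , proj₂ nz) , vanish
    where
    rec = linearly-dependent k (λ j l → w (suc j) (suc l))
    nz = proj₁ (proj₂ rec)
    c : Fin (suc (suc k)) → Carrier
    c zero    = 0#
    c (suc j) = proj₁ rec j
    vanish : ∀ l → sum (λ j → c j * w j l) ≡ 0#
    vanish zero    = sum-zero λ j → trans (cong (c j *_) (column≡0 j)) (zeroʳ (c j))
    vanish (suc l) = trans (cong₂ _+_ (zeroˡ _) (proj₂ (proj₂ rec) l)) (+-identityˡ 0#)
  ... | no column≢0 = c , (punchIn i (proj₁ nz) , proj₂ nz ∘ trans (sym (insertAt-punchIn c′ i _ _))) , vanish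
    where
    pivot = ¬∀⟶∃¬ _ _ (λ j → w j zero ≟ 0#) column≢0
    i = proj₁ pivot
    τ : Fin (suc k) → Carrier
    τ j = - (w (punchIn i j) zero * w i zero ⁻¹)
    rec = linearly-dependent k (λ j l → w (punchIn i j) (suc l) + τ j * w i (suc l))
    c′ = proj₁ rec
    nz = proj₁ (proj₂ rec)
    -- The total multiple of the pivot vector that elimination added to the others, hence its
    -- coefficient in the relation.
    s = sum (λ j → c′ j * τ j)
    c = insertAt c′ i s

    τ-eliminates : ∀ j → w (punchIn i j) zero + τ j * w i zero ≡ 0#
    τ-eliminates j = begin
      a + - (a * b ⁻¹) * b    ≡⟨ cong (a +_) (-‿distribˡ-* _ _) ⟨
      a + - (a * b ⁻¹ * b)    ≡⟨ cong (λ t → a + - t) (trans (*-assoc _ _ _)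
                                 (trans (cong (a *_) (*-inverseˡ (proj₂ pivot))) (*-identityʳ a))) ⟩
      a + - a                 ≡⟨ -‿inverseʳ a ⟩
      0#                      ∎
      where
      a = w (punchIn i j) zero
      b = w i zero

    regroup : ∀ l → sum (λ j → c j * w j l) ≡ sum (λ j → c′ j * (w (punchIn i j) l + τ j * w i l))
    regroup l = begin
      sum (λ j → c j * w j l)
        ≡⟨ sum-remove {i = i} (λ j → c j * w j l) ⟩
      c i * w i l + sum (λ j → c (punchIn i j) * w (punchIn i j) l)
        ≡⟨ cong₂ _+_ (cong (_* w i l) (insertAt-lookup c′ i s))
                     (sum-cong-≗ λ j → cong (_* w (punchIn i j) l) (insertAt-punchIn c′ i s j)) ⟩
      sum (λ j → c′ j * τ j) * w i l + sum (λ j → c′ j * w (punchIn i j) l)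
        ≡⟨ cong (_+ sum (λ j → c′ j * w (punchIn i j) l)) (*-distribʳ-sum (w i l) (λ j → c′ j * τ j)) ⟩
      sum (λ j → c′ j * τ j * w i l) + sum (λ j → c′ j * w (punchIn i j) l)
        ≡⟨ ∑-distrib-+ (λ j → c′ j * τ j * w i l) (λ j → c′ j * w (punchIn i j) l) ⟨
      sum (λ j → c′ j * τ j * w i l + c′ j * w (punchIn i j) l)
        ≡⟨ sum-cong-≗ (λ j → solve 4 (λ c t u v → c :* t :* u :+ c :* v := c :* (v :+ t :* u)) refl
                                    (c′ j) (τ j) (w i l) (w (punchIn i j) l)) ⟩
      sum (λ j → c′ j * (w (punchIn i j) l + τ j * w i l)) ∎

    vanish : ∀ l → sum (λ j → c j * w j l) ≡ 0#
    vanish zero    = trans (regroup zero) (sum-zero λ j → trans (cong (c′ j *_) (τ-eliminates j)) (zeroʳ (c′ j)))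
    vanish (suc l) = trans (regroup (suc l)) (proj₂ (proj₂ rec) l)

  -- Polynomials as coefficient vectors: division by a linear factor, roots.

  -- Coefficients are listed from the constant term upwards.
  eval : ∀ {n} → Vec Carrier n → Carrier → Carrier
  eval []      x = 0#
  eval (c ∷ P) x = c + x * eval P x

  -- Synthetic division by `X - r`: the coefficients of the quotient are the Horner values at `r` of
  -- the successive tails of the polynomial.
  quotient : ∀ {n} → Carrier → Vec Carrier (suc n) → Vec Carrier n
  quotient r (c ∷ [])        = []
  quotient r (c ∷ P@(_ ∷ _)) = eval P r ∷ quotient r P

  -- With quotient `Q`, this is `P(x) - P(r) = (x - r) Q(x)`, arranged without subtraction so that
  -- semiring identities suffice.
  eval-quotient : ∀ {n} r (P : Vec Carrier (suc n)) x →
    eval P x + r * eval (quotient r P) x ≡ eval P r + x * eval (quotient r P) x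
  eval-quotient r (c ∷ []) x = solve 3 (λ r c x → c :+ x :* con 0 :+ r :* con 0 := c :+ r :* con 0 :+ x :* con 0) refl r c x
  eval-quotient r (c ∷ P@(_ ∷ _)) x = begin
    c + x * e x + r * (e r + x * q)   ≡⟨ solve 6 (λ c x r a b q →
                                           c :+ x :* a :+ r :* (b :+ x :* q) := c :+ r :* b :+ x :* (a :+ r :* q))
                                           refl c x r (e x) (e r) q ⟩
    c + r * e r + x * (e x + r * q)   ≡⟨ cong (λ t → c + r * e r + x * t) (eval-quotient r P x) ⟩
    c + r * e r + x * (e r + x * q)   ∎
    where
    e = eval P
    q = eval (quotient r P) x

  -- The head of the quotient is the value at `r` of the tail of `P`. If the quotient vanishes, that
  -- tail therefore has the root `r` and a vanishing quotient of its own, and the recursion applies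
  -- to it.
  quotient≡0 : ∀ {n} r (P : Vec Carrier (suc n)) → quotient r P ≡ replicate n 0# → eval P r ≡ 0# →
    P ≡ replicate (suc n) 0#
  quotient≡0 r (c ∷ []) _ root = cong (_∷ []) (trans (sym (trans (cong (c +_) (zeroʳ r)) (+-identityʳ c))) root)
  quotient≡0 r (c ∷ P@(_ ∷ _)) q≡0 root with ∷-injective q≡0
  ... | Pr≡0 , q′≡0 = cong₂ _∷_
    (trans (sym (trans (cong (λ t → c + r * t) Pr≡0) (trans (cong (c +_) (zeroʳ r)) (+-identityʳ c)))) root)
    (quotient≡0 r P q′≡0 Pr≡0)

  -- Dividing by the first root leaves a polynomial with one coefficient fewer, and the other roots,
  -- being different from the first, are roots of it.
  enough-roots⇒zero : ∀ {n} (P : Vec Carrier n) (z : Fin n → Carrier) → Injective _≡_ _≡_ z →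
    (∀ j → eval P (z j) ≡ 0#) → P ≡ replicate n 0#
  enough-roots⇒zero {zero}  []        z z-inj root = refl
  enough-roots⇒zero {suc n} P         z z-inj root =
    quotient≡0 r P (enough-roots⇒zero (quotient r P) (z ∘ suc) (suc-injective ∘ z-inj) quotient-root) (root zero)
    where
    r = z zero
    quotient-root : ∀ j → eval (quotient r P) (z (suc j)) ≡ 0#
    quotient-root j = decidable-stable (q ≟ 0#) λ q≢0 →
      contradiction (z-inj (*-cancelʳ q≢0 (+-cancelˡ 0# _ _ shifted))) λ ()
      where
      x = z (suc j)
      q = eval (quotient r P) x
      shifted : 0# + r * q ≡ 0# + x * q
      shifted = begin
        0# + r * q          ≡⟨ cong (_+ r * q) (root (suc j)) ⟨
        eval P x + r * q    ≡⟨ eval-quotient r P x ⟩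
        eval P r + x * q    ≡⟨ cong (_+ x * q) (root zero) ⟩
        0# + x * q          ∎

  affine-two-roots : ∀ {a b x y} → x ≢ y → a + b * x ≡ 0# → a + b * y ≡ 0# → a ≡ 0# × b ≡ 0#
  affine-two-roots {a} {b} {x} {y} x≢y ax ay =
    let P≡0 = enough-roots⇒zero (a ∷ b ∷ []) (lookup (x ∷ y ∷ [])) z-inj root
    in proj₁ (∷-injective P≡0) , proj₁ (∷-injective (proj₂ (∷-injective P≡0)))
    where
    z-inj : Injective _≡_ _≡_ (lookup (x ∷ y ∷ []))
    z-inj {0F} {0F} _  = refl
    z-inj {0F} {1F} eq = contradiction eq x≢y
    z-inj {1F} {0F} eq = contradiction (sym eq) x≢y
    z-inj {1F} {1F} _  = refl
    eval-affine : ∀ u → eval (a ∷ b ∷ []) u ≡ a + b * u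
    eval-affine u = solve 3 (λ a b u → a :+ u :* (b :+ u :* con 0) := a :+ b :* u) refl a b u
    root : ∀ j → eval (a ∷ b ∷ []) (lookup (x ∷ y ∷ []) j) ≡ 0#
    root 0F = trans (eval-affine x) ax
    root 1F = trans (eval-affine y) ay

  eval-map : ∀ {n} a (P : Vec Carrier n) x → eval (map (a *_) P) x ≡ a * eval P x
  eval-map a []      x = sym (zeroʳ a)
  eval-map a (c ∷ P) x = trans (cong (λ t → a * c + x * t) (eval-map a P x))
    (solve 4 (λ a c x e → a :* c :+ x :* (a :* e) := a :* (c :+ x :* e)) refl a c x (eval P x))

  -- The coefficients of A² + σ v B, where A = a + b v + c v² and B = a′ + b′ v + c′ v².
  square-plus-multiple : (a b c a′ b′ c′ σ : Carrier) → Vec Carrier 5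
  square-plus-multiple a b c a′ b′ c′ σ =
    a * a ∷ a * b + a * b + σ * a′ ∷ b * b + (a * c + a * c) + σ * b′ ∷ b * c + b * c + σ * c′ ∷ c * c ∷ []

  eval-square-plus-multiple : ∀ a b c a′ b′ c′ σ v → eval (square-plus-multiple a b c a′ b′ c′ σ) v ≡
    eval (a ∷ b ∷ c ∷ []) v * eval (a ∷ b ∷ c ∷ []) v + σ * (v * eval (a′ ∷ b′ ∷ c′ ∷ []) v)
  eval-square-plus-multiple a b c a′ b′ c′ σ v = solve 8 (λ a b c a′ b′ c′ σ v →
    a :* a :+ v :* (a :* b :+ a :* b :+ σ :* a′ :+ v :* (b :* b :+ (a :* c :+ a :* c) :+ σ :* b′ :+
      v :* (b :* c :+ b :* c :+ σ :* c′ :+ v :* (c :* c :+ v :* con 0))))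
    := (a :+ v :* (b :+ v :* (c :+ v :* con 0))) :* (a :+ v :* (b :+ v :* (c :+ v :* con 0))) :+
       σ :* (v :* (a′ :+ v :* (b′ :+ v :* (c′ :+ v :* con 0)))))
    refl a b c a′ b′ c′ σ v

  -- Linear forms on a plane, evaluated at five of its points.

  module LinearForms (coef : Fin 5 → Fin 3 → Carrier) where

    -- `coef k` is the coordinate triple of point `k` in the plane, so this describes the
    -- restrictions of linear functionals to the five points.
    Form : (Fin 5 → Carrier) → Set
    Form φ = ∃ λ (A : Fin 3 → Carrier) → ∀ k → φ k ≡ sum (λ l → A l * coef k l)

    Form-scale : ∀ a {φ ψ} → (∀ k → ψ k ≡ a * φ k) → Form φ → Form ψ
    Form-scale a {φ} {ψ} ψ≡aφ (A , φ≡A) = (λ l → a * A l) , λ k → begin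
      ψ k                                ≡⟨ ψ≡aφ k ⟩
      a * φ k                            ≡⟨ cong (a *_) (φ≡A k) ⟩
      a * sum (λ l → A l * coef k l)     ≡⟨ *-distribˡ-sum a (λ l → A l * coef k l) ⟩
      sum (λ l → a * (A l * coef k l))   ≡⟨ sum-cong-≗ (λ l → sym (*-assoc a (A l) (coef k l))) ⟩
      sum (λ l → a * A l * coef k l)     ∎

    abstract
      -- Functionals on a plane have three coefficients each, so four coefficient vectors are
      -- dependent, and their relation carries over to the values.
      four-forms-dependent : (φ : Fin 4 → Fin 5 → Carrier) → (∀ j → Form (φ j)) →
        ∃ λ (d : Fin 4 → Carrier) → (∃ λ j → d j ≢ 0#) × (∀ k → sum (λ j → d j * φ j k) ≡ 0#)
      four-forms-dependent φ form with linearly-dependent 3 (λ j → proj₁ (form j))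
      ... | d , nz , dA≡0 = d , nz , λ k → begin
        sum (λ j → d j * φ j k)
          ≡⟨ sum-cong-≗ (λ j → trans (cong (d j *_) (proj₂ (form j) k)) (*-distribˡ-sum (d j) (λ l → A j l * coef k l))) ⟩
        sum (λ j → sum (λ l → d j * (A j l * coef k l)))
          ≡⟨ ∑-comm (λ j l → d j * (A j l * coef k l)) ⟩
        sum (λ l → sum (λ j → d j * (A j l * coef k l)))
          ≡⟨ sum-cong-≗ (λ l → sum-cong-≗ λ j → sym (*-assoc (d j) (A j l) (coef k l))) ⟩
        sum (λ l → sum (λ j → d j * A j l * coef k l))
          ≡⟨ sum-cong-≗ (λ l → *-distribʳ-sum (coef k l) (λ j → d j * A j l)) ⟨
        sum (λ l → sum (λ j → d j * A j l) * coef k l)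
          ≡⟨ sum-zero (λ l → trans (cong (_* coef k l) (dA≡0 l)) (zeroˡ (coef k l))) ⟩
        0# ∎
        where
        A : Fin 4 → Fin 3 → Carrier
        A j = proj₁ (form j)

    -- A relation among `g`, 1, `v` and `v²` can be solved for `g`: without a `g` term it would be a
    -- polynomial of degree at most 2 in `v` with the three roots `v (t i)`, so all its coefficients
    -- would vanish.
    form-is-quadratic : ∀ {v g} (t : Fin 3 → Fin 5) → Injective _≡_ _≡_ (v ∘ t) →
      Form (const 1#) → Form v → Form (λ k → v k * v k) → Form g →
      ∃ λ (P : Vec Carrier 3) → ∀ k → g k ≡ eval P (v k)
    form-is-quadratic {v} {g} t vt-inj form-1 form-v form-v² form-g
      with four-forms-dependent (lookup (g ∷ const 1# ∷ v ∷ (λ k → v k * v k) ∷ []))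
                                (λ { 0F → form-g ; 1F → form-1 ; 2F → form-v ; 3F → form-v² })
    ... | d , (j , dj≢0) , relation = map (e *_) P , λ k → trans (solve-linear d₀≢0 (split k)) (sym (eval-map e P (v k)))
      where
      e : Carrier
      e = - (d 0F ⁻¹)
      P : Vec Carrier 3
      P = d 1F ∷ d 2F ∷ d 3F ∷ []
      split : ∀ k → d 0F * g k + eval P (v k) ≡ 0#
      split k = trans (solve 6 (λ d₀ d₁ d₂ d₃ g v →
          d₀ :* g :+ (d₁ :+ v :* (d₂ :+ v :* (d₃ :+ v :* con 0)))
            := d₀ :* g :+ (d₁ :* con 1 :+ (d₂ :* v :+ (d₃ :* (v :* v) :+ con 0))))
          refl (d 0F) (d 1F) (d 2F) (d 3F) (g k) (v k)) (relation k)
      d₀≢0 : d 0F ≢ 0#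
      d₀≢0 d₀≡0 = dj≢0 (all-zero j)
        where
        P≡0 : P ≡ replicate 3 0#
        P≡0 = enough-roots⇒zero P (v ∘ t) vt-inj λ i → begin
          eval P (v (t i))                        ≡⟨ +-identityˡ _ ⟨
          0# + eval P (v (t i))                   ≡⟨ cong (_+ eval P (v (t i))) (trans (cong (_* g (t i)) d₀≡0) (zeroˡ _)) ⟨
          d 0F * g (t i) + eval P (v (t i))       ≡⟨ split (t i) ⟩
          0#                                      ∎
        all-zero : ∀ j → d j ≡ 0#
        all-zero 0F = d₀≡0
        all-zero (suc i) = trans (coefficient i) (lookup-replicate i 0#)
          where
          coefficient : ∀ i → d (suc i) ≡ lookup (replicate 3 0#) i
          coefficient 0F = cong (λ Q → lookup Q 0F) P≡0
          coefficient 1F = cong (λ Q → lookup Q 1F) P≡0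
          coefficient 2F = cong (λ Q → lookup Q 2F) P≡0

    -- The points t j lie on the line v = s of the plane, on which forms depend on one parameter only.
    form-is-affine-on-line : ∀ {v z g s} (t : Fin 3 → Fin 5) → (∀ j → v (t j) ≡ s) → ∀ k → v k ≢ s →
      ∀ j j′ → z (t j) ≢ z (t j′) → Form (const 1#) → Form v → Form z → Form g →
      ∃ λ (P : Vec Carrier 2) → ∀ j → g (t j) ≡ eval P (z (t j))
    form-is-affine-on-line {v} {z} {g} {s} t vt≡s k vk≢s j j′ z≢z′ form-1 form-v form-z form-g
      with four-forms-dependent (lookup (g ∷ z ∷ v ∷ const 1# ∷ []))
                                (λ { 0F → form-g ; 1F → form-z ; 2F → form-v ; 3F → form-1 })
    ... | d , (i , di≢0) , relation = map (e *_) P , λ j → trans (solve-linear d₀≢0 (split j)) (sym (eval-map e P (z (t j))))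
      where
      e : Carrier
      e = - (d 0F ⁻¹)
      P : Vec Carrier 2
      -- On the line `v` equals `s`, so its term joins the constant one.
      P = d 3F + d 2F * s ∷ d 1F ∷ []
      split : ∀ j → d 0F * g (t j) + eval P (z (t j)) ≡ 0#
      split j = begin
        d 0F * g (t j) + eval P (z (t j))
          ≡⟨ solve 7 (λ d₀ d₁ d₂ d₃ g z v →
               d₀ :* g :+ (d₃ :+ d₂ :* v :+ z :* (d₁ :+ z :* con 0))
                 := d₀ :* g :+ (d₁ :* z :+ (d₂ :* v :+ (d₃ :* con 1 :+ con 0))))
               refl (d 0F) (d 1F) (d 2F) (d 3F) (g (t j)) (z (t j)) s ⟩
        d 0F * g (t j) + (d 1F * z (t j) + (d 2F * s + (d 3F * 1# + 0#)))
          ≡⟨ cong (λ v → d 0F * g (t j) + (d 1F * z (t j) + (d 2F * v + (d 3F * 1# + 0#)))) (vt≡s j) ⟨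
        d 0F * g (t j) + (d 1F * z (t j) + (d 2F * v (t j) + (d 3F * 1# + 0#)))
          ≡⟨ relation (t j) ⟩
        0# ∎
      -- Without a `g` term, the relation on the line is affine in `z` and vanishes at two values of
      -- `z`. This kills `d 1F` and `d 3F + d 2F * s`; the point `k` off the line then kills `d 2F`
      -- and `d 3F`.
      d₀≢0 : d 0F ≢ 0#
      d₀≢0 d₀≡0 = di≢0 (all-zero i)
        where
        on-line : ∀ j → d 3F + d 2F * s + d 1F * z (t j) ≡ 0#
        on-line j = begin
          d 3F + d 2F * s + d 1F * z (t j)
            ≡⟨ solve 5 (λ d₁ d₂ d₃ z s → d₃ :+ d₂ :* s :+ d₁ :* z :=
                 con 0 :+ (d₃ :+ d₂ :* s :+ z :* (d₁ :+ z :* con 0))) refl (d 1F) (d 2F) (d 3F) (z (t j)) s ⟩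
          0# + eval P (z (t j))
            ≡⟨ cong (_+ eval P (z (t j))) (trans (cong (_* g (t j)) d₀≡0) (zeroˡ _)) ⟨
          d 0F * g (t j) + eval P (z (t j))
            ≡⟨ split j ⟩
          0# ∎
        d₁≡0 : d 1F ≡ 0#
        d₁≡0 = proj₂ (affine-two-roots z≢z′ (on-line j) (on-line j′))
        off-line : d 3F + d 2F * v k ≡ 0#
        off-line = begin
          d 3F + d 2F * v k
            ≡⟨ solve 5 (λ d₂ d₃ v g z → d₃ :+ d₂ :* v :=
                 con 0 :* g :+ (con 0 :* z :+ (d₂ :* v :+ (d₃ :* con 1 :+ con 0)))) refl (d 2F) (d 3F) (v k) (g k) (z k) ⟩
          0# * g k + (0# * z k + (d 2F * v k + (d 3F * 1# + 0#)))
            ≡⟨ cong₂ (λ d₀ d₁ → d₀ * g k + (d₁ * z k + (d 2F * v k + (d 3F * 1# + 0#)))) d₀≡0 d₁≡0 ⟨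
          d 0F * g k + (d 1F * z k + (d 2F * v k + (d 3F * 1# + 0#)))
            ≡⟨ relation k ⟩
          0# ∎
        d₃,d₂≡0 : d 3F ≡ 0# × d 2F ≡ 0#
        d₃,d₂≡0 = affine-two-roots (vk≢s ∘ sym) (proj₁ (affine-two-roots z≢z′ (on-line j) (on-line j′))) off-line
        all-zero : ∀ i → d i ≡ 0#
        all-zero 0F = d₀≡0
        all-zero 1F = d₁≡0
        all-zero 2F = proj₂ d₃,d₂≡0
        all-zero 3F = proj₁ d₃,d₂≡0

    -- Five coplanar points, each given by sequences with `xᵢ yᵢ = xᵢ₊₁²`.

    module _ (m : ℕ) (x y : Fin 5 → ℕ → Carrier)
      (x-start : ∀ k → x k 0 ≡ 1#) (x-end : ∀ k j → m ℕ.≤ j → x k j ≡ 1#)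
      (xy≡x² : ∀ k i → x k i * y k i ≡ x k (suc i) * x k (suc i))
      (form-x : ∀ i → Form (λ k → x k i)) (form-y : ∀ i → Form (λ k → y k i))
      (x-inj : ∀ {a b} → (∀ i → x a i ≡ x b i) → a ≡ b)
      where

      form-1 : Form (const 1#)
      form-1 = Form-scale 1# (λ k → sym (trans (*-identityˡ _) (x-start k))) (form-x 0)

      -- The identity A² = ρvB holds at five points, hence as polynomials; comparing extreme
      -- coefficients, A is a multiple of v.
      square-root-is-multiple : ∀ {v} → Injective _≡_ _≡_ v → ∀ i ρ (A B : Vec Carrier 3) →
        (∀ k → x k i ≡ ρ * v k) → (∀ k → x k (suc i) ≡ eval A (v k)) → (∀ k → y k i ≡ eval B (v k)) →
        ∃ λ ρ′ → ∀ k → x k (suc i) ≡ ρ′ * v k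
      square-root-is-multiple {v} v-inj i ρ (a ∷ b ∷ c ∷ []) (a′ ∷ b′ ∷ c′ ∷ []) x≡ρv x≡A y≡B = b , λ k → begin
        x k (suc i)                                      ≡⟨ x≡A k ⟩
        a + v k * (b + v k * (c + v k * 0#))             ≡⟨ cong₂ (λ a c → a + v k * (b + v k * (c + v k * 0#))) a≡0 c≡0 ⟩
        0# + v k * (b + v k * (0# + v k * 0#))           ≡⟨ solve 2 (λ b v →
                                                              con 0 :+ v :* (b :+ v :* (con 0 :+ v :* con 0)) := b :* v) refl b (v k) ⟩
        b * v k                                          ∎
        where
        σ = - ρ
        D : Vec Carrier 5
        D = square-plus-multiple a b c a′ b′ c′ σ
        D-root : ∀ k → eval D (v k) ≡ 0#
        D-root k = begin
          eval D (v k)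
            ≡⟨ eval-square-plus-multiple a b c a′ b′ c′ σ (v k) ⟩
          eval (a ∷ b ∷ c ∷ []) (v k) * eval (a ∷ b ∷ c ∷ []) (v k) + σ * (v k * eval (a′ ∷ b′ ∷ c′ ∷ []) (v k))
            ≡⟨ cong₂ (λ X Y → X * X + σ * (v k * Y)) (x≡A k) (y≡B k) ⟨
          x k (suc i) * x k (suc i) + σ * (v k * y k i)
            ≡⟨ cong (_+ σ * (v k * y k i)) (xy≡x² k i) ⟨
          x k i * y k i + σ * (v k * y k i)
            ≡⟨ cong (λ X → X * y k i + σ * (v k * y k i)) (x≡ρv k) ⟩
          ρ * v k * y k i + σ * (v k * y k i)
            ≡⟨ solve 4 (λ ρ σ v y → ρ :* v :* y :+ σ :* (v :* y) := (ρ :+ σ) :* (v :* y)) refl ρ σ (v k) (y k i) ⟩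
          (ρ + σ) * (v k * y k i)
            ≡⟨ cong (_* (v k * y k i)) (-‿inverseʳ ρ) ⟩
          0# * (v k * y k i)
            ≡⟨ zeroˡ _ ⟩
          0# ∎
        D≡0 : D ≡ replicate 5 0#
        D≡0 = enough-roots⇒zero D v v-inj D-root
        a≡0 : a ≡ 0#
        a≡0 = square-zero (cong (λ Q → lookup Q 0F) D≡0)
        c≡0 : c ≡ 0#
        c≡0 = square-zero (cong (λ Q → lookup Q 4F) D≡0)

      multiple-propagates : ∀ {v} → Injective _≡_ _≡_ v → Form v → Form (λ k → v k * v k) →
        ∀ i ρ → (∀ k → x k i ≡ ρ * v k) → ∃ λ ρ′ → ∀ k → x k (suc i) ≡ ρ′ * v k
      multiple-propagates {v} v-inj form-v form-v² i ρ x≡ρv =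
        let A , x≡A = quadratic (form-x (suc i))
            B , y≡B = quadratic (form-y i)
        in square-root-is-multiple v-inj i ρ A B x≡ρv x≡A y≡B
        where
        v≢ : ∀ {a b} → a ≢ b → v a ≢ v b
        v≢ a≢b = a≢b ∘ v-inj
        quadratic : ∀ {g} → Form g → ∃ λ (P : Vec Carrier 3) → ∀ k → g k ≡ eval P (v k)
        quadratic = form-is-quadratic (lookup (0F ∷ 1F ∷ 2F ∷ []))
          (triple-injective v (v≢ λ ()) (v≢ λ ()) (v≢ λ ())) form-1 form-v form-v²

      -- Where `xᵢ` is constant, `xᵢ₊₁² = xᵢ yᵢ` is a scalar multiple of the form `yᵢ`.
      square-form : ∀ i → (∀ k → x k i ≡ x 0F i) → Form (λ k → x k (suc i) * x k (suc i))
      square-form i x-const = Form-scale (x 0F i)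
        (λ k → trans (sym (xy≡x² k i)) (cong (_* y k i) (x-const k))) (form-y i)

      not-injective-after-constant : ∀ i → (∀ k → x k i ≡ x 0F i) → ¬ Injective _≡_ _≡_ (λ k → x k (suc i))
      not-injective-after-constant i x-const v-inj = contradiction (v-inj v₀≡v₁) λ ()
        where
        v : Fin 5 → Carrier
        v k = x k (suc i)
        multiple : ∀ j → ∃ λ ρ → ∀ k → x k (j ℕ.+ suc i) ≡ ρ * v k
        multiple zero    = 1# , λ k → sym (*-identityˡ _)
        multiple (suc j) = multiple-propagates v-inj (form-x (suc i)) (square-form i x-const) (j ℕ.+ suc i)
          (proj₁ (multiple j)) (proj₂ (multiple j))
        -- Index `m + suc i` lies past the end, where the sequence is 1, so `v` would be constant.
        ρ = proj₁ (multiple m)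
        ρv≡1 : ∀ k → ρ * v k ≡ 1#
        ρv≡1 k = trans (sym (proj₂ (multiple m) k)) (x-end k (m ℕ.+ suc i) (m≤m+n m (suc i)))
        ρ≢0 : ρ ≢ 0#
        ρ≢0 ρ≡0 = 0≢1 (trans (sym (zeroˡ (v 0F))) (trans (cong (_* v 0F) (sym ρ≡0)) (ρv≡1 0F)))
        v₀≡v₁ : v 0F ≡ v 1F
        v₀≡v₁ = *-cancelˡ ρ≢0 (trans (ρv≡1 0F) (sym (ρv≡1 1F)))

      -- The three points agree at every index, by induction along the sequence, and so coincide. At
      -- a first disagreement `z`, every form is affine in `z` on the line.
      no-three-collinear : ∀ {v s} (t : Fin 3 → Fin 5) → Injective _≡_ _≡_ t → Form v →
        (∀ j → v (t j) ≡ s) → ∀ k → v k ≢ s → ⊥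
      no-three-collinear {v} {s} t t-inj form-v vt≡s k vk≢s =
        contradiction (t-inj (x-inj λ i → sym (constant i 1F))) λ ()
        where
        constant : ∀ i j → x (t j) i ≡ x (t 0F) i
        constant zero    j = trans (x-start (t j)) (sym (x-start (t 0F)))
        constant (suc i) with all? (λ j → x (t j) (suc i) ≟ x (t 0F) (suc i))
        ... | yes const = const
        ... | no ¬const = contradiction 1≡0 (0≢1 ∘ sym)
          where
          z : Fin 5 → Carrier
          z k = x k (suc i)
          witness = ¬∀⟶∃¬ _ _ (λ j → x (t j) (suc i) ≟ x (t 0F) (suc i)) ¬const
          affine : ∀ {g} → Form g → ∃ λ (P : Vec Carrier 2) → ∀ j → g (t j) ≡ eval P (z (t j))
          affine = form-is-affine-on-line t vt≡s k vk≢s (proj₁ witness) 0F (proj₂ witness) form-1 form-v (form-x (suc i))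
          -- Each term of the sequence is a function of `z` on the line, so `z` determines the
          -- point.
          zt-inj : Injective _≡_ _≡_ (z ∘ t)
          zt-inj {j} {j′} zj≡zj′ = t-inj (x-inj λ l → let P , g≡P = affine (form-x l) in
            trans (g≡P j) (trans (cong (eval P) zj≡zj′) (sym (g≡P j′))))
          -- On the line, z² would be both u · y and an affine function of z.
          u = x (t 0F) i
          P = proj₁ (affine (form-y i))
          Q : Vec Carrier 3
          Q = - u * lookup P 0F ∷ - u * lookup P 1F ∷ 1# ∷ []
          Q-root : ∀ j → eval Q (z (t j)) ≡ 0#
          Q-root j = begin
            eval Q Z
              ≡⟨ solve 4 (λ a b n z → n :* a :+ z :* (n :* b :+ z :* (con 1 :+ z :* con 0))
                   := z :* z :+ n :* (a :+ z :* (b :+ z :* con 0))) refl (lookup P 0F) (lookup P 1F) (- u) Z ⟩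
            Z * Z + - u * eval (lookup P 0F ∷ lookup P 1F ∷ []) Z
              ≡⟨ cong₂ (λ a b → a + - u * b) (sym (xy≡x² (t j) i))
                   (sym (trans (proj₂ (affine (form-y i)) j) (cong (λ P → eval P Z) (two P)))) ⟩
            x (t j) i * Y + - u * Y
              ≡⟨ cong (λ a → a * Y + - u * Y) (constant i j) ⟩
            u * Y + - u * Y
              ≡⟨ distribʳ Y u (- u) ⟨
            (u + - u) * Y
              ≡⟨ cong (_* Y) (-‿inverseʳ u) ⟩
            0# * Y
              ≡⟨ zeroˡ Y ⟩
            0# ∎
            where
            Z = z (t j)
            Y = y (t j) i
            two : ∀ (P : Vec Carrier 2) → P ≡ lookup P 0F ∷ lookup P 1F ∷ []
            two (a ∷ b ∷ []) = refl
          -- `Q` is a monic quadratic with three distinct roots.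
          1≡0 : 1# ≡ 0#
          1≡0 = cong (λ Q → lookup Q 2F) (enough-roots⇒zero Q (z ∘ t) zt-inj Q-root)

      constant-propagates : ∀ i → (∀ k → x k i ≡ x 0F i) → ∀ k → x k (suc i) ≡ x 0F (suc i)
      constant-propagates i x-const with all? (λ k → x k (suc i) ≟ x 0F (suc i))
      ... | yes const = const
      ... | no ¬const = ⊥-elim absurd
        where
        v : Fin 5 → Carrier
        v k = x k (suc i)
        witness = ¬∀⟶∃¬ _ _ (λ k → x k (suc i) ≟ x 0F (suc i)) ¬const
        b = proj₁ witness
        vb≢v₀ = proj₂ witness
        third-value? : Dec (∃ λ c → v c ≢ v 0F × v c ≢ v b)
        third-value? = any? λ c → ¬? (v c ≟ v 0F) ×-dec ¬? (v c ≟ v b)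
        absurd : ⊥
        absurd with third-value?
        -- With three values available, every `xⱼ` is a quadratic in `v`, so `v` determines the
        -- point.
        ... | yes (c , vc≢v₀ , vc≢vb) = not-injective-after-constant i x-const λ {k} {l} vk≡vl →
                x-inj λ j → let P , g≡P = form-is-quadratic (lookup (0F ∷ b ∷ c ∷ []))
                                  (triple-injective v (vb≢v₀ ∘ sym) (vc≢v₀ ∘ sym) (vc≢vb ∘ sym))
                                  form-1 (form-x (suc i)) (square-form i x-const) (form-x j)
                            in trans (g≡P k) (trans (cong (eval P) vk≡vl) (sym (g≡P l)))
        -- Five points and two values: three points share one, and a point with the other value lies
        -- off their line.
        ... | no ¬third with three-alike two-values
          where
          two-values : ∀ k → v k ≡ v 0F ⊎ v k ≡ v b
          two-values k with v k ≟ v 0F | v k ≟ v b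
          ... | yes p | _     = inj₁ p
          ... | no _  | yes q = inj₂ q
          ... | no p  | no q  = contradiction (k , p , q) ¬third
        ... | t , t-inj , inj₁ vt≡v₀ = no-three-collinear t t-inj (form-x (suc i)) vt≡v₀ b vb≢v₀
        ... | t , t-inj , inj₂ vt≡vb = no-three-collinear t t-inj (form-x (suc i)) vt≡vb 0F (vb≢v₀ ∘ sym)

      -- All sequences start at 1, and agreement passes from each index to the next, so points 0 and
      -- 1 would coincide.
      no-five-coplanar : ⊥
      no-five-coplanar = contradiction (x-inj {1F} {0F} λ i → constant i 1F) λ ()
        where
        constant : ∀ i k → x k i ≡ x 0F i
        constant zero    k = trans (x-start k) (sym (x-start 0F))
        constant (suc i) k = constant-propagates i (constant i) k

  -- The sequences attached to a vector of nonzero parameters.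

  at : ∀ {r} → Vec Carrier r → ℕ → Carrier
  at []       _       = 1#
  at (x ∷ xs) zero    = x
  at (x ∷ xs) (suc i) = at xs i

  -- Since `at` is 1 past the end, the sequence closes up: x₀ = xᵣ₊₁ = 1.
  cycle : ∀ {r} → Vec Carrier r → ℕ → Carrier
  cycle xs zero    = 1#
  cycle xs (suc i) = at xs i

  ratio : ∀ {r} → Vec Carrier r → ℕ → Carrier
  ratio xs i = cycle xs (suc i) * cycle xs (suc i) * cycle xs i ⁻¹

  at-nonzero : ∀ {r} {xs : Vec Carrier r} → All (_≢ 0#) xs → ∀ i → at xs i ≢ 0#
  at-nonzero []         i       = 0≢1 ∘ sym
  at-nonzero (x≢0 ∷ _)  zero    = x≢0
  at-nonzero (_ ∷ xs≢0) (suc i) = at-nonzero xs≢0 i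

  cycle-nonzero : ∀ {r} {xs : Vec Carrier r} → All (_≢ 0#) xs → ∀ i → cycle xs i ≢ 0#
  cycle-nonzero xs≢0 zero    = 0≢1 ∘ sym
  cycle-nonzero xs≢0 (suc i) = at-nonzero xs≢0 i

  at-end : ∀ {r} (xs : Vec Carrier r) {i} → r ℕ.≤ i → at xs i ≡ 1#
  at-end []       _         = refl
  at-end (x ∷ xs) (s≤s r≤i) = at-end xs r≤i

  cycle-end : ∀ {r} (xs : Vec Carrier r) {i} → suc r ℕ.≤ i → cycle xs i ≡ 1#
  cycle-end xs (s≤s r≤i) = at-end xs r≤i

  cycle-ratio : ∀ {r} {xs : Vec Carrier r} → All (_≢ 0#) xs →
    ∀ i → cycle xs i * ratio xs i ≡ cycle xs (suc i) * cycle xs (suc i)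
  cycle-ratio {xs = xs} xs≢0 i = begin
    u * (w * w * u ⁻¹)   ≡⟨ solve 3 (λ u w n → u :* (w :* w :* n) := w :* w :* (u :* n)) refl u w (u ⁻¹) ⟩
    w * w * (u * u ⁻¹)   ≡⟨ cong (w * w *_) (*-inverseʳ (cycle-nonzero xs≢0 i)) ⟩
    w * w * 1#           ≡⟨ *-identityʳ _ ⟩
    w * w                ∎
    where
    u = cycle xs i
    w = cycle xs (suc i)

  ratio-end : ∀ {r} (xs : Vec Carrier r) {i} → suc r ℕ.≤ i → ratio xs i ≡ 1#
  ratio-end xs {i} r<i = begin
    w * w * u ⁻¹       ≡⟨ cong₂ (λ w u → w * w * u ⁻¹) (cycle-end xs (m≤n⇒m≤1+n r<i)) (cycle-end xs r<i) ⟩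
    1# * 1# * 1# ⁻¹    ≡⟨ cong (_* 1# ⁻¹) (*-identityˡ 1#) ⟩
    1# * 1# ⁻¹         ≡⟨ *-inverseʳ (0≢1 ∘ sym) ⟩
    1#                 ∎
    where
    u = cycle xs i
    w = cycle xs (suc i)

  at-injective : ∀ {r} {xs ys : Vec Carrier r} → (∀ i → at xs i ≡ at ys i) → xs ≡ ys
  at-injective {xs = []}     {[]}     eq = refl
  at-injective {xs = x ∷ xs} {y ∷ ys} eq = cong₂ _∷_ (eq 0) (at-injective (eq ∘ suc))

  cycle-injective : ∀ {r} {xs ys : Vec Carrier r} → (∀ i → cycle xs i ≡ cycle ys i) → xs ≡ ys
  cycle-injective eq = at-injective (eq ∘ suc)

  -- The points in projective space of dimension `2r + 1`.

  module PointSet (r : ℕ) where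
    open Geometry 𝔽 (2 ℕ.* suc r ∸ 1)

    -- The final `++ []` gives the length `suc r + (suc r + 0)`, which is what `2 * suc r` computes
    -- to.
    point : Vec Carrier r → V
    point xs = tabulate {n = suc r} (cycle xs ∘ toℕ) ++ (tabulate {n = suc r} (ratio xs ∘ toℕ) ++ [])

    cycle-index ratio-index : Fin (suc r) → Fin (suc (2 ℕ.* suc r ∸ 1))
    cycle-index i = i ↑ˡ (suc r ℕ.+ 0)
    ratio-index i = suc r ↑ʳ (i ↑ˡ 0)

    lookup-cycle : ∀ xs i → lookup (point xs) (cycle-index i) ≡ cycle xs (toℕ i)
    lookup-cycle xs i = trans (lookup-++ˡ (tabulate {n = suc r} (cycle xs ∘ toℕ)) _ i)
      (lookup∘tabulate (cycle xs ∘ toℕ) i)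

    lookup-ratio : ∀ xs i → lookup (point xs) (ratio-index i) ≡ ratio xs (toℕ i)
    lookup-ratio xs i = trans (lookup-++ʳ (tabulate {n = suc r} (cycle xs ∘ toℕ)) _ (i ↑ˡ 0))
      (trans (lookup-++ˡ (tabulate {n = suc r} (ratio xs ∘ toℕ)) [] i) (lookup∘tabulate (ratio xs ∘ toℕ) i))

    -- Coordinates of a point cover only the indices up to `r`; the sequences run over all of ℕ and
    -- are 1 from `suc r` on.
    ∀-split : ∀ {P : ℕ → Set} → (∀ (i : Fin (suc r)) → P (toℕ i)) → (∀ i → suc r ℕ.≤ i → P i) → ∀ i → P i
    ∀-split {P} below above i with suc r ℕ.≤? i
    ... | yes r<i = above i r<i
    ... | no  r≮i = subst P (toℕ-fromℕ< (≰⇒> r≮i)) (below (fromℕ< (≰⇒> r≮i)))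

    point≢𝟎 : ∀ xs → point xs ≢ 𝟎
    point≢𝟎 xs eq = 0≢1 (sym (proj₁ (∷-injective eq)))

    same-point⇒≡ : ∀ {xs ys} → SamePoint (point xs) (point ys) → xs ≡ ys
    same-point⇒≡ {xs} {ys} (μ , eq) = cycle-injective (∀-split below λ i r<i →
        trans (cycle-end xs r<i) (sym (cycle-end ys r<i)))
      where
      μ≡1 : μ ≡ 1#
      -- Both vectors have first coordinate `x₀ = 1`, which fixes the scalar.
      μ≡1 = trans (sym (*-identityʳ μ)) (sym (proj₁ (∷-injective eq)))
      below : ∀ i → cycle xs (toℕ i) ≡ cycle ys (toℕ i)
      below i = begin
        cycle xs (toℕ i)                              ≡⟨ lookup-cycle xs i ⟨
        lookup (point xs) (cycle-index i)             ≡⟨ cong (λ v → lookup v (cycle-index i)) eq ⟩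
        lookup (μ · point ys) (cycle-index i)         ≡⟨ lookup-map (cycle-index i) (μ *_) (point ys) ⟩
        μ * lookup (point ys) (cycle-index i)         ≡⟨ cong₂ _*_ μ≡1 (lookup-cycle ys i) ⟩
        1# * cycle ys (toℕ i)                         ≡⟨ *-identityˡ _ ⟩
        cycle ys (toℕ i)                              ∎

    -- Each coordinate is a form in the coefficients supplied by `span`. The constant 1 is the form
    -- `x₀`, which also covers all terms past the end.
    five-points-not-coplanar : (p : Fin 5 → Vec Carrier r) → Injective _≡_ _≡_ p → (∀ k → All (_≢ 0#) (p k)) →
      ∀ a b c → (∀ k → InSpan a b c (point (p k))) → ⊥
    five-points-not-coplanar p p-inj p≢0 a b c span =
      no-five-coplanar (suc r) (cycle ∘ p) (ratio ∘ p) (λ _ → refl) (λ k j → cycle-end (p k))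
        (λ k → cycle-ratio (p≢0 k))
        (∀-split (λ i → Form-≗ (λ k → sym (lookup-cycle (p k) i)) (coordinate-form (cycle-index i)))
                 (λ i r<i → Form-≗ (λ k → cycle-end (p k) r<i) constant-form))
        (∀-split (λ i → Form-≗ (λ k → sym (lookup-ratio (p k) i)) (coordinate-form (ratio-index i)))
                 (λ i r<i → Form-≗ (λ k → ratio-end (p k) r<i) constant-form))
        (p-inj ∘ cycle-injective)
      where
      coef : Fin 5 → Fin 3 → Carrier
      coef k = lookup (let α , β , γ , _ = span k in α ∷ β ∷ γ ∷ [])
      open LinearForms coef
      Form-≗ : ∀ {φ ψ} → (∀ k → ψ k ≡ φ k) → Form φ → Form ψ
      Form-≗ ψ≗φ (A , φ≡A) = A , λ k → trans (ψ≗φ k) (φ≡A k)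
      coordinate-form : ∀ i → Form (λ k → lookup (point (p k)) i)
      coordinate-form i = lookup (lookup a i ∷ lookup b i ∷ lookup c i ∷ []) , λ k →
        let α , β , γ , eq = span k in begin
        lookup (point (p k)) i
          ≡⟨ cong (λ v → lookup v i) eq ⟩
        lookup (((α · a) ⊕ (β · b)) ⊕ (γ · c)) i
          ≡⟨ lookup-zipWith _+_ i ((α · a) ⊕ (β · b)) (γ · c) ⟩
        lookup ((α · a) ⊕ (β · b)) i + lookup (γ · c) i
          ≡⟨ cong (_+ lookup (γ · c) i) (lookup-zipWith _+_ i (α · a) (β · b)) ⟩
        lookup (α · a) i + lookup (β · b) i + lookup (γ · c) i
          ≡⟨ cong₂ _+_ (cong₂ _+_ (lookup-map i (α *_) a) (lookup-map i (β *_) b)) (lookup-map i (γ *_) c) ⟩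
        α * lookup a i + β * lookup b i + γ * lookup c i
          ≡⟨ solve 6 (λ α β γ a b c → α :* a :+ β :* b :+ γ :* c := a :* α :+ (b :* β :+ (c :* γ :+ con 0)))
               refl α β γ (lookup a i) (lookup b i) (lookup c i) ⟩
        lookup a i * α + (lookup b i * β + (lookup c i * γ + 0#)) ∎
      constant-form : Form (const 1#)
      constant-form = Form-≗ (λ k → sym (lookup-cycle (p k) 0F)) (coordinate-form (cycle-index 0F))

    points-form-42-set : (L : List (Vec Carrier r)) → Unique L → ListAll.All (All (_≢ 0#)) L → Is42Set (List.map point L)
    points-form-42-set L L! L≢0 =
      ( ListAll.map⁺ (ListAll.universal point≢𝟎 L)
      , AllPairs.map⁺ (AllPairs.map (λ xs≢ys → xs≢ys ∘ same-point⇒≡) L!)) ,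
      λ a b c _ Y Y⊆X inSpan → at-most-four a b c Y Y⊆X inSpan
      where
      at-most-four : ∀ a b c Y → Y ⊆ List.map point L → ListAll.All (InSpan a b c) Y → length Y ℕ.≤ 4
      at-most-four a b c Y Y⊆X inSpan with ⊆-map⁻ point L Y⊆X
      ... | Z , Z⊆L , refl with length Z ℕ.≤? 4
      ... | yes Z≤4 = subst (ℕ._≤ 4) (sym (length-map point Z)) Z≤4
      -- The first five entries of `Z` are distinct parameter vectors of coplanar points.
      ... | no  Z≰4 = ⊥-elim (five-points-not-coplanar p p-inj
              (λ k → ListAll.lookup (All-resp-⊆ Z⊆L L≢0) (∈-lookup (inject≤ k 5≤Z))) a b c
              (λ k → ListAll.lookup (ListAll.map⁻ inSpan) (∈-lookup (inject≤ k 5≤Z))))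
        where
        5≤Z = ≰⇒> Z≰4
        p : Fin 5 → Vec Carrier r
        p k = List.lookup Z (inject≤ k 5≤Z)
        p-inj : Injective _≡_ _≡_ p
        p-inj eq = inject≤-injective 5≤Z 5≤Z _ _ (lookup-injective (AllPairs-resp-⊆ Z⊆L L!) eq)

  -- Counting: there are `(q - 1)ʳ` parameter vectors.

  nonzero : List Carrier
  nonzero = filter (λ x → ¬? (x ≟ 0#)) elements

  length-nonzero : order ≡ suc (length nonzero)
  length-nonzero = length-filter-≢ _≟_ elements-unique (elements-complete 0#)

  vectors : ∀ r → List (Vec Carrier r)
  vectors zero    = [] ∷ []
  vectors (suc r) = cartesianProductWith _∷_ nonzero (vectors r)

  vectors-unique : ∀ r → Unique (vectors r)
  vectors-unique zero    = [] ∷ []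
  vectors-unique (suc r) = Unique.cartesianProductWith⁺ _∷_ ∷-injective (Unique.filter⁺ _ elements-unique) (vectors-unique r)

  vectors-nonzero : ∀ r → ListAll.All (All (_≢ 0#)) (vectors r)
  vectors-nonzero zero    = [] ∷ []
  vectors-nonzero (suc r) = ListAll.cartesianProductWith⁺ (setoid _) (setoid _) _∷_ nonzero (vectors r) λ x∈ xs∈ →
    ListAll.lookup (ListAll.all-filter (λ x → ¬? (x ≟ 0#)) elements) x∈ ∷ ListAll.lookup (vectors-nonzero r) xs∈

  length-vectors : ∀ r → length (vectors r) ≡ length nonzero ℕ.^ r
  length-vectors zero    = refl
  length-vectors (suc r) = trans (length-cartesianProductWith _∷_ nonzero (vectors r))
    (cong (length nonzero ℕ.*_) (length-vectors r))


-- Comparison of `(q - 1)ʳ` with `qʳ`.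

open import Data.Nat using (ℕ; suc; _≤_; _*_; _∸_; _^_; _+_)
open import Data.Nat.Properties using (n≤1+n; *-assoc; *-monoʳ-≤; *-monoˡ-≤; +-monoˡ-≤; ^-monoˡ-≤; +-cancelˡ-≤; *-cancelʳ-≤; *-mono-≤; module ≤-Reasoning)
open import Data.Nat.Tactic.RingSolver using (solve-∀)
open ≤-Reasoning

-- Bernoulli's inequality `(1 - 1/q)ʳ ≥ 1 - r/q` for `q = n + 1`, multiplied by `qʳ⁺¹` to stay
-- within the naturals.
bernoulli : ∀ n r → suc n ^ r * suc n ≤ n ^ r * suc n + r * suc n ^ r
bernoulli n zero    = m≤m+n _ _
bernoulli n (suc r) = begin
  q * Q * q                          ≡⟨ *-assoc q Q q ⟩
  q * (Q * q)                        ≤⟨ *-monoʳ-≤ q (bernoulli n r) ⟩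
  q * (N * q + r * Q)                ≡⟨ identity n N r Q ⟩
  N * q + (n * N * q + r * (q * Q))  ≤⟨ +-monoˡ-≤ _ (*-monoˡ-≤ q (^-monoˡ-≤ r (n≤1+n n))) ⟩
  Q * q + (n * N * q + r * (q * Q))  ≡⟨ identity′ n N r Q ⟩
  n * N * q + suc r * (q * Q)        ∎
  where
  q = suc n
  Q = suc n ^ r
  N = n ^ r
  identity : ∀ n N r Q → suc n * (N * suc n + r * Q) ≡ N * suc n + (n * N * suc n + r * (suc n * Q))
  identity = solve-∀
  identity′ : ∀ n N r Q → Q * suc n + (n * N * suc n + r * (suc n * Q)) ≡ n * N * suc n + suc r * (suc n * Q)
  identity′ = solve-∀

-- In `k + 1` times Bernoulli's inequality, the error term is at most `q Q` by hypothesis;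
-- cancelling the factor `q` and one `Q` leaves the bound.
power-lower-bound : ∀ k r n → suc k * r ≤ suc n → k * suc n ^ r ≤ suc k * n ^ r
power-lower-bound k r n kr≤q = +-cancelˡ-≤ Q _ _ (*-cancelʳ-≤ _ _ (suc n) (begin
  suc k * Q * q                  ≡⟨ *-assoc (suc k) Q q ⟩
  suc k * (Q * q)                ≤⟨ *-monoʳ-≤ (suc k) (bernoulli n r) ⟩
  suc k * (N * q + r * Q)        ≡⟨ identity (suc k) N q r Q ⟩
  suc k * r * Q + suc k * N * q  ≤⟨ +-monoˡ-≤ _ (*-monoˡ-≤ Q kr≤q) ⟩
  q * Q + suc k * N * q          ≡⟨ identity′ (suc k) N q Q ⟩
  (Q + suc k * N) * q            ∎))
  where
  q = suc n
  Q = suc n ^ r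
  N = n ^ r
  identity : ∀ k N q r Q → k * (N * q + r * Q) ≡ k * r * Q + k * N * q
  identity = solve-∀
  identity′ : ∀ k N q Q → q * Q + k * N * q ≡ (Q + k * N) * q
  identity′ = solve-∀

-- The factor `1 + o(1)` is unfolded: for each `k`, all large `q` give a size within `1 ± 1/k` times
-- `q` to the power `(n - 1)/2 = m - 1`.
theorem11 : (m : ℕ) → 2 ≤ m →
    ∀ (k : ℕ) → 1 ≤ k → ∃ λ (Q : ℕ) → ∀ (𝔽 : FiniteField) → Q ≤ FiniteField.order 𝔽 →
    Σ (List (Geometry.V 𝔽 (2 * m ∸ 1))) λ X →
    Geometry.Is42Set 𝔽 (2 * m ∸ 1) X ×
    ((k ∸ 1) * FiniteField.order 𝔽 ^ (m ∸ 1) ≤ k * length X) ×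
    (k * length X ≤ (k + 1) * FiniteField.order 𝔽 ^ (m ∸ 1))
-- In the `k` of the statement the threshold is `k r`, which makes the relative error `r/q` at most
-- `1/k`. The upper bound is just `(q - 1)ʳ ≤ qʳ`.
theorem11 (suc r) _ (suc k) _ = suc k * r , λ 𝔽 kr≤q →
  let open Field 𝔽 using (nonzero; vectors; vectors-unique; vectors-nonzero; length-vectors; length-nonzero; module PointSet)
      open PointSet r
      size = trans (length-map point (vectors r)) (length-vectors r)
      n = length nonzero
  in List.map point (vectors r)
   , points-form-42-set (vectors r) (vectors-unique r) (vectors-nonzero r)
   , subst₂ (λ q l → k * q ^ r ≤ suc k * l) (sym length-nonzero) (sym size)
       (power-lower-bound k r n (subst (suc k * r ≤_) length-nonzero kr≤q))
   , subst₂ (λ q l → suc k * l ≤ (suc k + 1) * q ^ r) (sym length-nonzero) (sym size)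
       (*-mono-≤ (m≤m+n (suc k) 1) (^-monoˡ-≤ r (n≤1+n n)))
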